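{- There is an algorithm that, given a (directed or undirected) edge-labeled graph $G$ with $m$ edges, a vertex $v$ of $G$, and a label $x$, identifies in $O(m)$ time all edges of $G$ that belong to nonrepetitive paths of $G$ that have $v$ as their initial vertex and $x$ as their initial edge label.
   Context: Graphs are finite, each edge carries one label, and multiple edges are allowed. Isolated vertices are disregarded. Paths are not required to be simple: they may repeat vertices and edges (in a directed graph they follow edge directions, in an undirected graph edges may be traversed in either direction). A path is nonrepetitive if no two consecutive edges of it share the same label. The edges incident to each vertex of the input are assumed to be given grouped according to their labels. Running times are on a standard random-access machine. -}

module Defs where

open import Data.Bool.Base using (if_then_else_)
open import Data.Fin.Base using (Fin; toℕ)
open import Data.List.Base
  using (List; []; _∷_; _++_; map; head; drop; take; concat; length; lookup; tabulate)
open import Data.List.Membership.Propositional using (_∈_)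
open import Data.List.Relation.Unary.Linked using (Linked)
open import Data.List.Relation.Unary.Unique.Propositional using (Unique)
open import Data.Maybe.Base using (Maybe; just; nothing; fromMaybe)
open import Data.Nat.Base using (ℕ; suc; _+_; _∸_; _≡ᵇ_)
open import Data.Product.Base using (Σ-syntax; ∃-syntax; _×_; _,_)
open import Data.Sum.Base using (_⊎_)
import Data.Fin.Base as Fin
open import Function.Bundles using (_⇔_)
open import Relation.Binary.Construct.Closure.ReflexiveTransitive using (Star; ε; _◅_)
open import Relation.Binary.PropositionalEquality.Core using (_≡_; _≢_)

data Kind : Set where
  directed undirected : Kind

-- In an undirected graph the source and target of an edge are its two
-- endpoints in arbitrary order.  Self-loops are allowed.
record Graph : Set where
  field
    kind   : Kind
    n m    : ℕ
    source : Fin m → Fin n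
    target : Fin m → Fin n
    label  : Fin m → ℕ
    noIsolated : ∀ u → ∃[ e ] (source e ≡ u ⊎ target e ≡ u)

  Vertex Edge : Set
  Vertex = Fin n
  Edge   = Fin m

  Incident : Edge → Vertex → Set
  Incident e u = source e ≡ u ⊎ target e ≡ u

module _ (G : Graph) where
  open Graph G

  data Crosses (e : Edge) : Vertex → Vertex → Set where
    forward  : Crosses e (source e) (target e)
    backward : kind ≡ undirected → Crosses e (target e) (source e)

  Path : Vertex → Vertex → Set
  Path = Star (λ u w → ∃[ e ] Crosses e u w)

  edges : ∀ {u w} → Path u w → List Edge
  edges ε             = []
  edges ((e , _) ◅ p) = e ∷ edges p

  Nonrepetitive : ∀ {u w} → Path u w → Set
  Nonrepetitive p = Linked (λ e f → label e ≢ label f) (edges p)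

  InitialLabel : ∀ {u w} → ℕ → Path u w → Set
  InitialLabel x p = head (map label (edges p)) ≡ just x

  OnNonrepetitivePath : Vertex → ℕ → Edge → Set
  OnNonrepetitivePath v x e =
    ∃[ w ] Σ[ p ∈ Path v w ] (Nonrepetitive p × InitialLabel x p × e ∈ edges p)

  -- Equal labels occupy a contiguous block of the list.
  Grouped : List Edge → Set
  Grouped es = ∀ (i j k : Fin (length es)) → i Fin.≤ j → j Fin.≤ k →
    label (lookup es i) ≡ label (lookup es k) →
    label (lookup es j) ≡ label (lookup es i)

  -- Also in a directed graph, the edges incident to a vertex are both
  -- the outgoing and the incoming ones.  A self-loop is listed once.
  record IncidenceLists : Set where
    field
      incident : Vertex → List Edge
      complete : ∀ u e → e ∈ incident u ⇔ Incident e u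
      unique   : ∀ u → Unique (incident u)
      grouped  : ∀ u → Grouped (incident u)

    lists : List (List Edge)
    lists = tabulate incident

    start : ℕ → ℕ
    start u = length (concat (take u lists))

-- Uniform-cost RAM in the style of Cook and Reckhow: registers and
-- memory cells hold natural numbers, subtraction is truncated, and there
-- is no multiplication, so unit cost per instruction is reasonable.

Register Address : Set
Register = ℕ
Address  = ℕ

data Instruction : Set where
  const : (r : Register) (c : ℕ) → Instruction
  add   : (r s t : Register) → Instruction
  sub   : (r s t : Register) → Instruction
  load  : (r s : Register) → Instruction
  store : (r s : Register) → Instruction
  jump  : (l : ℕ) → Instruction
  jumpZ : (r : Register) (l : ℕ) → Instruction
  emit  : (r : Register) → Instruction
  halt  : Instruction

Program : Set
Program = List Instruction

record Config : Set where
  constructor config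
  field
    pc     : ℕ
    regs   : Register → ℕ
    mem    : Address → ℕ
    output : List ℕ

_[_≔_] : (ℕ → ℕ) → ℕ → ℕ → (ℕ → ℕ)
(f [ a ≔ x ]) b = if b ≡ᵇ a then x else f b

-- The result is nothing when the machine halts.
execute : Instruction → Config → Maybe Config
execute (const r c) (config p ρ μ o) = just (config (suc p) (ρ [ r ≔ c ]) μ o)
execute (add r s t) (config p ρ μ o) = just (config (suc p) (ρ [ r ≔ ρ s + ρ t ]) μ o)
execute (sub r s t) (config p ρ μ o) = just (config (suc p) (ρ [ r ≔ ρ s ∸ ρ t ]) μ o)
execute (load r s)  (config p ρ μ o) = just (config (suc p) (ρ [ r ≔ μ (ρ s) ]) μ o)
execute (store r s) (config p ρ μ o) = just (config (suc p) ρ (μ [ ρ r ≔ ρ s ]) o)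
execute (jump l)    (config p ρ μ o) = just (config l ρ μ o)
execute (jumpZ r l) (config p ρ μ o) =
  just (config (if ρ r ≡ᵇ 0 then l else suc p) ρ μ o)
execute (emit r)    (config p ρ μ o) = just (config (suc p) ρ μ (o ++ ρ r ∷ []))
execute halt        _                = nothing

-- A program counter beyond the end of the program means halting.
step : Program → Config → Maybe Config
step P κ = execute (fromMaybe halt (head (drop (Config.pc κ) P))) κ

data HaltsIn (P : Program) : Config → ℕ → List ℕ → Set where
  done : ∀ {κ} → step P κ ≡ nothing → HaltsIn P κ 0 (Config.output κ)
  next : ∀ {κ κ′ t o} → step P κ ≡ just κ′ → HaltsIn P κ′ t o →
         HaltsIn P κ (suc t) o

contents : List ℕ → Address → ℕ
contents ws a = fromMaybe 0 (head (drop a ws))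

-- The input is at addresses 0, 1, …; everything else is zero.
initial : List ℕ → Config
initial ws = config 0 (λ _ → 0) (contents ws) []

kindCode : Kind → ℕ
kindCode directed   = 0
kindCode undirected = 1

-- A header of five words, three arrays of length m indexed by edges, and
-- the incidence lists stored one after another, preceded by an array of
-- length n + 1 such that the list of vertex u occupies positions
-- start u, …, start (u + 1) - 1 of that last block.
encode : (G : Graph) → IncidenceLists G → Graph.Vertex G → ℕ → List ℕ
encode G I v x =
  kindCode kind ∷ n ∷ m ∷ toℕ v ∷ x ∷
  tabulate (λ e → toℕ (source e)) ++
  tabulate (λ e → toℕ (target e)) ++
  tabulate label ++
  tabulate {n = suc n} (λ u → start (toℕ u)) ++
  map toℕ (concat lists)
  where
  open Graph G
  open IncidenceLists I

-- The output names each edge with property Q exactly once, in any order.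
Identifies : ∀ {m} → List ℕ → (Fin m → Set) → Set
Identifies o Q =
  ∃[ es ] (o ≡ map toℕ es × Unique es × (∀ e → e ∈ es ⇔ Q e))

-- A breadth-first search over tasks "leave vertex z by an edge whose label is
-- not l".  Entering z by an edge labelled l creates that task; once z has been
-- entered by two distinct labels, the two tasks together let every label leave
-- z, so later entries are ignored.  Hence each vertex has at most two tasks, and
-- even if each of them scans the whole incidence list of z, the number of list
-- entries inspected is linear in the sum of the degrees, hence in m.
--
-- The running time is bounded by a potential: the entries still to be scanned
-- in the current list, the cost of the queued tasks, and for each vertex the
-- cost of the tasks that it may still create.

module Submission where

open import Defs
open import Data.Bool.Base using (true; false; if_then_else_)
open import Data.Empty using (⊥; ⊥-elim)
open import Data.Fin.Base using (Fin; zero; suc; toℕ; fromℕ; inject₁; _↑ˡ_; _↑ʳ_; splitAt)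
import Data.Fin.Properties as Fin
open import Data.List.Base
  using (List; []; _∷_; _++_; map; concat; concatMap; length; lookup; tabulate; take; upTo)
open import Data.List.Membership.Propositional using (_∈_; _∉_)
open import Data.List.Membership.Propositional.Properties
  using (∈-lookup; ∈-++⁺ˡ; ∈-++⁺ʳ; ∈-++⁻; ∈-map⁻)
open import Data.List.Properties
  using (length-tabulate; length-map; length-++; map-++; ++-assoc; take-all; concatMap-++; tabulate-cong)
open import Data.List.Relation.Binary.Disjoint.Propositional using (Disjoint)
open import Data.List.Relation.Unary.All as All using (All; []; _∷_)
import Data.List.Relation.Unary.All.Properties as All
open import Data.List.Relation.Unary.AllPairs using ([]; _∷_)
import Data.List.Relation.Unary.AllPairs.Properties as AllPairs
open import Data.List.Relation.Unary.Any using (here; there)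
open import Data.List.Relation.Unary.Linked using (Linked; []; [-]; _∷_)
open import Data.List.Relation.Unary.Unique.Propositional using (Unique)
import Data.List.Relation.Unary.Unique.Propositional.Properties as Unique
open import Data.Maybe.Base using (just; nothing)
open import Data.Maybe.Properties using (just-injective)
open import Data.Nat.Base
  using (ℕ; zero; suc; _+_; _*_; _∸_; _≤_; _<_; _≡ᵇ_; z≤n; s≤s; s≤s⁻¹)
open import Data.Nat.ListAction using (sum)
open import Data.Nat.ListAction.Properties using (sum-++)
open import Data.Nat.Properties as ℕ hiding (_≟_)
open import Data.Nat.Tactic.RingSolver using (solve-∀)
open import Data.Product.Base using (Σ-syntax; ∃-syntax; _×_; _,_; proj₁; proj₂)
open import Data.Sum.Base as Sum using (_⊎_; inj₁; inj₂)
open import Data.Unit.Base using (⊤; tt)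
open import Data.Vec.Functional using (updateAt)
open import Data.Vec.Functional.Properties using (updateAt-updates; updateAt-minimal)
open import Function.Base using (_∘_; id)
open import Function.Bundles using (mk⇔; Equivalence)
open import Relation.Binary.Construct.Closure.ReflexiveTransitive using (ε; _◅_)
open import Relation.Binary.PropositionalEquality
open import Relation.Nullary using (Dec; yes; no; ¬_; ¬?)

-- Runs of the machine

-- The search runs over tasks, but what is wanted is a set of edges. The link is that an edge counts
-- as served only when it is in the output and the status of its far end covers its label. Then the
-- next edge of a nonrepetitive path falls under a task of that end, and once nothing is waiting,
-- completeness is an induction along the path. Two facts keep the bound linear in `m` alone.
-- Isolated vertices are excluded, so `n` is at most `2 * m`, and a vertex to start from forces `m`
-- to be positive. Memory beyond the input is zero, which is made to mean "not emitted" and "not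
-- entered", so no array has to be cleared. The machine is treated by evaluation: blocks of
-- instructions run on symbolic registers, and only the outcomes of conditional jumps need an
-- argument.

module _ (P : Program) where

  run : ℕ → Config → Config
  run zero    κ = κ
  run (suc k) κ with step P κ
  ... | nothing = κ
  ... | just κ′ = run k κ′

  HaltsWithin : (List ℕ → Set) → ℕ → Config → Set
  HaltsWithin Q T κ = Σ[ t ∈ ℕ ] Σ[ o ∈ List ℕ ] (HaltsIn P κ t o × t ≤ T × Q o)

  module _ {Q : List ℕ → Set} where

    weaken : ∀ {T T′ κ} → T ≤ T′ → HaltsWithin Q T κ → HaltsWithin Q T′ κ
    weaken T≤T′ (t , o , h , t≤T , q) = t , o , h , ≤-trans t≤T T≤T′ , q

    steps : ∀ k {T κ} → HaltsWithin Q T (run k κ) → HaltsWithin Q (k + T) κ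
    steps zero    h = h
    steps (suc k) {T} {κ} h with step P κ in eq
    ... | nothing = weaken (m≤n+m T (suc k)) h
    ... | just κ′ with steps k h
    ...   | t , o , h′ , t≤T , q = suc t , o , next eq h′ , s≤s t≤T , q

    -- After a block ending in `jumpZ`, evaluation leaves the program counter stuck on a register
    -- value. The premise resolves it, while registers and memory stay as computed.
    runTo : ∀ k {T} p (κ : Config) → Config.pc (run k κ) ≡ p →
      HaltsWithin Q T (config p (Config.regs (run k κ)) (Config.mem (run k κ))
                                (Config.output (run k κ))) →
      HaltsWithin Q (k + T) κ
    runTo k p κ refl h = steps k h

-- Conditionals, memory updates and arrays in memory

if-zero : ∀ {a} {p q : ℕ} → a ≡ 0 → (if a ≡ᵇ 0 then p else q) ≡ p
if-zero refl = refl

if-nonzero : ∀ {a} {p q : ℕ} → a ≢ 0 → (if a ≡ᵇ 0 then p else q) ≡ q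
if-nonzero {zero}  a≢0 = ⊥-elim (a≢0 refl)
if-nonzero {suc a} _   = refl

≡ᵇ-refl : ∀ a → (a ≡ᵇ a) ≡ true
≡ᵇ-refl zero    = refl
≡ᵇ-refl (suc a) = ≡ᵇ-refl a

≡ᵇ-≢ : ∀ {a b} → a ≢ b → (a ≡ᵇ b) ≡ false
≡ᵇ-≢ {zero}  {zero}  a≢b = ⊥-elim (a≢b refl)
≡ᵇ-≢ {zero}  {suc b} _   = refl
≡ᵇ-≢ {suc a} {zero}  _   = refl
≡ᵇ-≢ {suc a} {suc b} a≢b = ≡ᵇ-≢ (a≢b ∘ cong suc)

update-same : ∀ (f : ℕ → ℕ) a {y} → (f [ a ≔ y ]) a ≡ y
update-same f a rewrite ≡ᵇ-refl a = refl

update-other : ∀ (f : ℕ → ℕ) {a b y} → b ≢ a → (f [ a ≔ y ]) b ≡ f b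
update-other f b≢a rewrite ≡ᵇ-≢ b≢a = refl

-- Carrying the end address as an index lets adjacent arrays be joined without arithmetic on
-- lengths, and for an empty list it leaves just the equation that the program tests by subtraction.
Segment : (Address → ℕ) → Address → List ℕ → Address → Set
Segment f i []       j = i ≡ j
Segment f i (y ∷ ys) j = f i ≡ y × Segment f (suc i) ys j

segment-≤ : ∀ {f i} ys {j} → Segment f i ys j → i ≤ j
segment-≤ []       i≡j     = ≤-reflexive i≡j
segment-≤ (y ∷ ys) (_ , s) = <⇒≤ (segment-≤ ys s)

segment-end : ∀ {f i} ys {j} → Segment f i ys j → i + length ys ≡ j
segment-end {i = i} []       i≡j     = trans (+-identityʳ i) i≡j
segment-end {i = i} (y ∷ ys) (_ , s) = trans (+-suc i (length ys)) (segment-end ys s)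

segment-++ : ∀ {f i} ys {zs j k} →
  Segment f i ys j → Segment f j zs k → Segment f i (ys ++ zs) k
segment-++ []       refl    s′ = s′
segment-++ (y ∷ ys) (e , s) s′ = e , segment-++ ys s s′

segment-split : ∀ {f i} ys {zs j} → Segment f i (ys ++ zs) j →
  Segment f i ys (i + length ys) × Segment f (i + length ys) zs j
segment-split {i = i} [] {zs} s = sym (+-identityʳ i) ,
  subst (λ a → Segment _ a zs _) (sym (+-identityʳ i)) s
segment-split {i = i} (y ∷ ys) (e , s)
  rewrite +-suc i (length ys) =
    let l , r = segment-split ys s in (e , l) , r

segment-lookup : ∀ {f i n} (g : Fin n → ℕ) {j} → Segment f i (tabulate g) j →
  ∀ u → f (i + toℕ u) ≡ g u
segment-lookup {i = i} g (e , s) zero    rewrite +-identityʳ i = e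
segment-lookup {i = i} g (e , s) (suc u) rewrite +-suc i (toℕ u) =
  segment-lookup (g ∘ suc) s u

segment-frame : ∀ {f i} ys {j a y} → a < i ⊎ j ≤ a →
  Segment f i ys j → Segment (f [ a ≔ y ]) i ys j
segment-frame []       _ s = s
segment-frame {f} {i} (y ∷ ys) {a = a} out (e , s) =
  trans (update-other f (i≢a out)) e , segment-frame ys (shift out) s
  where
  i≢a : a < i ⊎ _ ≤ a → i ≢ a
  i≢a (inj₁ a<i) refl = <-irrefl refl a<i
  i≢a (inj₂ j≤a) refl = <-irrefl refl (≤-trans (segment-≤ ys s) j≤a)
  shift : a < i ⊎ _ ≤ a → a < suc i ⊎ _ ≤ a
  shift (inj₁ a<i) = inj₁ (m<n⇒m<1+n a<i)
  shift (inj₂ j≤a) = inj₂ j≤a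

segment-write : ∀ {f i n} (g g′ : Fin n → ℕ) {j} u {y} →
  g′ u ≡ y → (∀ {w} → w ≢ u → g′ w ≡ g w) →
  Segment f i (tabulate g) j → Segment (f [ i + toℕ u ≔ y ]) i (tabulate g′) j
segment-write {f} {i} g g′ {j} zero {y} new old (e , s)
  rewrite +-identityʳ i =
    trans (update-same f i) (sym new) ,
    subst (λ ys → Segment (f [ i ≔ y ]) (suc i) ys j)
      (tabulate-cong (λ w → sym (old λ ())))
      (segment-frame (tabulate (g ∘ suc)) (inj₁ ≤-refl) s)
segment-write {f} {i} g g′ (suc u) new old (e , s)
  rewrite +-suc i (toℕ u) =
    trans (update-other f (<⇒≢ (s≤s (m≤m+n i (toℕ u))))) (trans e (sym (old λ ()))) ,
    segment-write (g ∘ suc) (g′ ∘ suc) u new (λ w≢u → old (w≢u ∘ Fin.suc-injective)) s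

segment-contents : ∀ ys → Segment (contents ys) 0 ys (length ys)
segment-contents []       = refl
segment-contents (y ∷ ys) = refl , shift ys (segment-contents ys)
  where
  shift : ∀ {i} zs {j} → Segment (contents ys) i zs j →
    Segment (contents (y ∷ ys)) (suc i) zs (suc j)
  shift []       s       = cong suc s
  shift (z ∷ zs) (e , s) = e , shift zs s

contents-beyond : ∀ ys k → contents ys (length ys + k) ≡ 0
contents-beyond []       zero    = refl
contents-beyond []       (suc k) = refl
contents-beyond (y ∷ ys) k       = contents-beyond ys k

segment-constant : ∀ {f y} i n → (∀ k → f (i + k) ≡ y) →
  Segment f i (tabulate {n = n} (λ _ → y)) (i + n)
segment-constant i zero    _ = sym (+-identityʳ i)
segment-constant {f} {y} i (suc n) h rewrite +-suc i n =
  trans (cong f (sym (+-identityʳ i))) (h 0) ,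
  segment-constant (suc i) n (λ k → trans (cong f (sym (+-suc i k))) (h (suc k)))

-- The search on abstract states

-- `only` occurs just in the initial task, which prescribes the label `x` at `v`; every task created
-- later is of the form `avoid`.
data Test : Set where
  only avoid : ℕ → Test

Passes : Test → ℕ → Set
Passes (only l)  l′ = l′ ≡ l
Passes (avoid l) l′ = l′ ≢ l

-- The labels with which a vertex has been entered so far; two distinct ones
-- already allow every label to leave it, so no more need to be remembered.
data Status : Set where
  fresh full : Status
  once       : ℕ → Status

Covers : Status → ℕ → Set
Covers fresh    _ = ⊥
Covers (once l) k = k ≡ l
Covers full     _ = ⊤

credit : Status → ℕ
credit fresh    = 2
credit (once _) = 1
credit full     = 0

-- Finite sums and duplicate-free lists

+-swap : ∀ a b c → a + (b + c) ≡ b + (a + c)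
+-swap = solve-∀

sum-tabulate-update : ∀ {n} (f g : Fin n → ℕ) u {c} →
  f u ≡ c + g u → (∀ {w} → w ≢ u → g w ≡ f w) →
  sum (tabulate f) ≡ c + sum (tabulate g)
sum-tabulate-update f g zero {c} new old
  rewrite new | tabulate-cong {f = g ∘ suc} {g = f ∘ suc} (λ w → old {suc w} λ ()) =
  +-assoc c (g zero) _
sum-tabulate-update f g (suc u) {c} new old
  rewrite sum-tabulate-update (f ∘ suc) (g ∘ suc) u {c} new (λ w≢u → old (w≢u ∘ Fin.suc-injective))
        | old {zero} (λ ()) = +-swap (f zero) c _

length-concat-tabulate : ∀ {A : Set} {n} (f : Fin n → List A) →
  length (concat (tabulate f)) ≡ sum (tabulate (length ∘ f))
length-concat-tabulate {n = zero}  f = refl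
length-concat-tabulate {n = suc n} f =
  trans (length-++ (f zero)) (cong (length (f zero) +_) (length-concat-tabulate (f ∘ suc)))

sum-tabulate-suc : ∀ {n} (f : Fin n → ℕ) → sum (tabulate (suc ∘ f)) ≡ n + sum (tabulate f)
sum-tabulate-suc {zero}  f = refl
sum-tabulate-suc {suc n} f rewrite sum-tabulate-suc (f ∘ suc) =
  cong suc (+-swap (f zero) n (sum (tabulate (f ∘ suc))))

sum-tabulate-* : ∀ {n} c (f : Fin n → ℕ) →
  sum (tabulate λ u → c * f u) ≡ c * sum (tabulate f)
sum-tabulate-* {zero}  c f = sym (*-zeroʳ c)
sum-tabulate-* {suc n} c f =
  trans (cong (c * f zero +_) (sum-tabulate-* c (f ∘ suc))) (sym (*-distribˡ-+ c (f zero) _))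

lookup-unique : ∀ {A : Set} {xs : List A} → Unique xs →
  ∀ {i j} → lookup xs i ≡ lookup xs j → i ≡ j
lookup-unique {xs = x ∷ xs} (_ ∷ _)  {zero}  {zero}  _  = refl
lookup-unique {xs = x ∷ xs} (x∉ ∷ _) {zero}  {suc j} eq = ⊥-elim (All.lookup x∉ (∈-lookup j) eq)
lookup-unique {xs = x ∷ xs} (x∉ ∷ _) {suc i} {zero}  eq = ⊥-elim (All.lookup x∉ (∈-lookup i) (sym eq))
lookup-unique {xs = x ∷ xs} (_ ∷ xs!) {suc i} {suc j} eq = cong suc (lookup-unique xs! eq)

unique-length : ∀ {n} {xs : List (Fin n)} → Unique xs → length xs ≤ n
unique-length xs! = Fin.injective⇒≤ (lookup-unique xs!)

Unique-∷ʳ : ∀ {A : Set} {xs : List A} {y} → Unique xs → y ∉ xs → Unique (xs ++ y ∷ [])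
Unique-∷ʳ xs! y∉xs = Unique.++⁺ xs! ([] ∷ []) λ { (y∈xs , here refl) → y∉xs y∈xs }

-- The invariant of the search and its preservation

module Search (G : Graph) (I : IncidenceLists G) (v : Graph.Vertex G) (x : ℕ) where
  open Graph G
  open IncidenceLists I

  Task : Set
  Task = Vertex × Test

  -- How a walk can be continued depends only on its last edge and the end where it stands, so
  -- nothing else of the walk is kept.
  data Arrives : Edge → Vertex → Set where
    first : ∀ {e y} → Crosses G e v y → label e ≡ x → Arrives e y
    later : ∀ {e f y z} → Arrives e y → Crosses G f y z → label f ≢ label e → Arrives f z

  -- The path is assembled from its end: q is the part already built after e.
  extendBack : ∀ {e y w} → Arrives e y → (q : Path G y w) →
    Linked (λ e f → label e ≢ label f) (e ∷ edges G q) →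
    Σ[ p ∈ Path G v w ] (Nonrepetitive G p × InitialLabel G x p ×
      (∀ {f} → f ∈ e ∷ edges G q → f ∈ edges G p))
  extendBack {e} (first c eq) q l = (e , c) ◅ q , l , cong just eq , id
  extendBack {e} (later a c ne) q l =
    let p , np , ip , ⊆p = extendBack a ((e , c) ◅ q) (ne ∘ sym ∷ l)
    in p , np , ip , ⊆p ∘ there

  arrives⇒onPath : ∀ {e y} → Arrives e y → OnNonrepetitivePath G v x e
  arrives⇒onPath {y = y} a =
    let p , np , ip , ⊆p = extendBack a ε [-] in y , p , np , ip , ⊆p (here refl)

  crosses-incident : ∀ {e y z} → Crosses G e y z → Incident e y
  crosses-incident forward      = inj₁ refl
  crosses-incident (backward _) = inj₂ refl

  Admissible : Task → Set
  Admissible (z , only l)  = z ≡ v × l ≡ x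
  Admissible (z , avoid l) = ∃[ e ] (Arrives e z × label e ≡ l)

  admissible-arrives : ∀ τ {e y} → Admissible τ → Crosses G e (proj₁ τ) y →
    Passes (proj₂ τ) (label e) → Arrives e y
  admissible-arrives (_ , only _)  (refl , refl)  c p = first c p
  admissible-arrives (_ , avoid _) (_ , a , refl) c p = later a c p

  record State : Set where
    constructor state
    field
      found  : List Edge
      status : Vertex → Status
      queue  : List Task
      task   : Task
      rem    : List Edge

  Served : State → Edge → Vertex → Set
  Served (state found status _ _ _) e y = e ∈ found × Covers (status y) (label e)

  -- A queued task still has all its edges ahead, but the current one is partly done and must be
  -- tracked edge by edge.
  Waiting : State → Task → Edge → Set
  Waiting (state _ _ queue task rem) τ e = τ ∈ queue ⊎ (τ ≡ task × e ∈ rem)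

  Handled : State → Task → Set
  Handled σ τ@(z , t) = ∀ {e y} → Crosses G e z y → Passes t (label e) →
    Served σ e y ⊎ Waiting σ τ e

  StatusHandled : State → Vertex → Status → Set
  StatusHandled σ z fresh    = ⊤
  StatusHandled σ z (once l) = Handled σ (z , avoid l)
  StatusHandled σ z full     = ∃[ l ] ∃[ k ]
    (l ≢ k × Handled σ (z , avoid l) × Handled σ (z , avoid k))

  record Invariant (σ : State) : Set where
    open State σ
    field
      admissible  : Admissible task
      admissibles : All Admissible queue
      arrived     : ∀ {e} → e ∈ found → ∃[ y ] Arrives e y
      unique!     : Unique found
      rem⊆        : ∀ {e} → e ∈ rem → Incident e (proj₁ task)
      initially   : Handled σ (v , only x)
      handled     : ∀ z → StatusHandled σ z (status z)

  open Invariant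

  -- This reduces the preservation of every `Handled` fact to two checks per transition: nothing
  -- served is lost, and whatever stops waiting has been served.
  record _⊑_ (σ σ′ : State) : Set where
    field
      served  : ∀ {e y} → Served σ e y → Served σ′ e y
      waiting : ∀ τ {e y} → Crosses G e (proj₁ τ) y → Passes (proj₂ τ) (label e) →
                Waiting σ τ e → Served σ′ e y ⊎ Waiting σ′ τ e

  Handled-⊑ : ∀ {σ σ′ τ} → σ ⊑ σ′ → Handled σ τ → Handled σ′ τ
  Handled-⊑ {τ = τ} le h c p =
    Sum.[ inj₁ ∘ _⊑_.served le , _⊑_.waiting le τ c p ] (h c p)

  StatusHandled-⊑ : ∀ {σ σ′} → σ ⊑ σ′ → ∀ z s → StatusHandled σ z s → StatusHandled σ′ z s
  StatusHandled-⊑ le z fresh    h = tt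
  StatusHandled-⊑ le z (once l) h = Handled-⊑ {τ = z , avoid l} le h
  StatusHandled-⊑ le z full (l , k , ne , h , h′) =
    l , k , ne , Handled-⊑ {τ = z , avoid l} le h , Handled-⊑ {τ = z , avoid k} le h′

  -- No obligation is lost, because `Handled` speaks only of edges that can be crossed and pass the
  -- test. The premise thus covers both a failed test and a directed edge that merely enters `z`.
  skip : ∀ {found status queue z t e rem} →
    Invariant (state found status queue (z , t) (e ∷ rem)) →
    (∀ {y} → Crosses G e z y → ¬ Passes t (label e)) →
    Invariant (state found status queue (z , t) rem)
  skip inv blocked = record
    { admissible  = admissible inv
    ; admissibles = admissibles inv
    ; arrived     = arrived inv
    ; unique!     = unique! inv
    ; rem⊆        = rem⊆ inv ∘ there
    ; initially   = Handled-⊑ le (initially inv)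
    ; handled     = λ u → StatusHandled-⊑ le u _ (handled inv u)
    }
    where
    le : _ ⊑ _
    le = record
      { served  = id
      ; waiting = λ { τ c p (inj₁ τ∈)                 → inj₂ (inj₁ τ∈)
                    ; τ c p (inj₂ (refl , here refl)) → ⊥-elim (blocked c p)
                    ; τ c p (inj₂ (refl , there e∈))  → inj₂ (inj₂ (refl , e∈)) }
      }

  -- Recording the traversed edge makes no progress on the current list: its
  -- other end has to be visited as well before the edge is served.
  record Crossing (found : List Edge) (status : Vertex → Status) (queue : List Task)
                  (z : Vertex) (t : Test) (e : Edge) (rem : List Edge) (y : Vertex) : Set where
    field
      inv     : Invariant (state found status queue (z , t) (e ∷ rem))
      crosses : Crosses G e z y
      -- An undirected self-loop can be crossed in both directions, but they lead to the same end,
      -- so a single visit serves the edge.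
      only-y  : ∀ {y′} → Crosses G e z y′ → y′ ≡ y
      passes  : Passes t (label e)

  open Crossing

  emitNew : ∀ {found status queue z t e rem y} →
    Crossing found status queue z t e rem y → e ∉ found →
    Crossing (found ++ e ∷ []) status queue z t e rem y
  emitNew {found} {status} {queue} {z} {t} {e} {rem} {y} cr e∉ = record
    { inv = record
      { admissible  = admissible (inv cr)
      ; admissibles = admissibles (inv cr)
      ; arrived     = arrived′ ∘ ∈-++⁻ found
      ; unique!     = Unique-∷ʳ (unique! (inv cr)) e∉
      ; rem⊆        = rem⊆ (inv cr)
      ; initially   = Handled-⊑ le (initially (inv cr))
      ; handled     = λ u → StatusHandled-⊑ le u _ (handled (inv cr) u)
      }
    ; crosses = crosses cr
    ; only-y  = only-y cr
    ; passes  = passes cr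
    }
    where
    arrived′ : ∀ {f} → f ∈ found ⊎ f ∈ e ∷ [] → ∃[ y ] Arrives f y
    arrived′ (inj₁ f∈)          = arrived (inv cr) f∈
    arrived′ (inj₂ (here refl)) =
      y , admissible-arrives (z , t) (admissible (inv cr)) (crosses cr) (passes cr)
    le : _ ⊑ _
    le = record
      { served  = λ (f∈ , cov) → ∈-++⁺ˡ f∈ , cov
      ; waiting = λ _ _ _ → inj₂
      }

  visitCovered : ∀ {found status queue z t e rem y} →
    Crossing found status queue z t e rem y → e ∈ found → Covers (status y) (label e) →
    Invariant (state found status queue (z , t) rem)
  visitCovered {status = status} cr e∈ cov = record
    { admissible  = admissible (inv cr)
    ; admissibles = admissibles (inv cr)
    ; arrived     = arrived (inv cr)
    ; unique!     = unique! (inv cr)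
    ; rem⊆        = rem⊆ (inv cr) ∘ there
    ; initially   = Handled-⊑ le (initially (inv cr))
    ; handled     = λ u → StatusHandled-⊑ le u _ (handled (inv cr) u)
    }
    where
    le : _ ⊑ _
    le = record
      { served  = id
      ; waiting = λ { τ c p (inj₁ τ∈)                 → inj₂ (inj₁ τ∈)
                    ; τ c p (inj₂ (refl , here refl)) →
                        inj₁ (e∈ , subst (λ u → Covers (status u) _) (sym (only-y cr c)) cov)
                    ; τ c p (inj₂ (refl , there e∈))  → inj₂ (inj₂ (refl , e∈)) }
      }

  -- These are exactly the entries by a label that is not yet covered. Each creates one task and
  -- uses up one unit of credit.
  data Entered : Status → ℕ → Status → Set where
    fresh : ∀ {l}   → Entered fresh l (once l)
    again : ∀ {l k} → l ≢ k → Entered (once k) l full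

  visitNew : ∀ {found status queue z t e rem y s} →
    Crossing found status queue z t e rem y → e ∈ found → Entered (status y) (label e) s →
    Invariant (state found (updateAt status y (λ _ → s)) (queue ++ (y , avoid (label e)) ∷ []) (z , t) rem)
  visitNew {found} {status} {queue} {z} {t} {e} {rem} {y} {s} cr e∈ ent = record
    { admissible  = admissible (inv cr)
    ; admissibles = All.++⁺ (admissibles (inv cr)) ((e , arrival , refl) ∷ [])
    ; arrived     = arrived (inv cr)
    ; unique!     = unique! (inv cr)
    ; rem⊆        = rem⊆ (inv cr) ∘ there
    ; initially   = Handled-⊑ le (initially (inv cr))
    ; handled     = handled′
    }
    where
    status′ = updateAt status y (λ _ → s)
    σ′ = state found status′ (queue ++ (y , avoid (label e)) ∷ []) (z , t) rem
    arrival = admissible-arrives (z , t) (admissible (inv cr)) (crosses cr) (passes cr)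
    entered-covers : ∀ {s₀ l} → Entered s₀ l s → Covers s l
    entered-covers fresh     = refl
    entered-covers (again _) = tt
    entered-mono : ∀ {s₀ l k} → Entered s₀ l s → Covers s₀ k → Covers s k
    entered-mono (again _) _ = tt
    cov-y : Covers (status′ y) (label e)
    cov-y = subst (λ s′ → Covers s′ (label e)) (sym (updateAt-updates y status)) (entered-covers ent)
    mono : ∀ u {l} → Covers (status u) l → Covers (status′ u) l
    mono u cov with u Fin.≟ y
    ... | yes refl = subst (λ s′ → Covers s′ _) (sym (updateAt-updates y status)) (entered-mono ent cov)
    ... | no u≢y   = subst (λ s′ → Covers s′ _) (sym (updateAt-minimal u y status u≢y)) cov
    le : state found status queue (z , t) (e ∷ rem) ⊑ σ′
    le = record
      { served  = λ { {y = u} (f∈ , cov) → f∈ , mono u cov }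
      ; waiting = λ { τ c p (inj₁ τ∈)                 → inj₂ (inj₁ (∈-++⁺ˡ τ∈))
                    ; τ c p (inj₂ (refl , here refl)) →
                        inj₁ (e∈ , subst (λ u → Covers (status′ u) _) (sym (only-y cr c)) cov-y)
                    ; τ c p (inj₂ (refl , there e∈))  → inj₂ (inj₂ (refl , e∈)) }
      }
    pending : Handled σ′ (y , avoid (label e))
    pending _ _ = inj₂ (inj₁ (∈-++⁺ʳ queue (here refl)))
    handled-y : ∀ {s₀} → Entered s₀ (label e) s → StatusHandled σ′ y s₀ → StatusHandled σ′ y s
    handled-y fresh      h = pending
    -- `full` stores no label, so the two survive only as existential witnesses: the label entering
    -- now and the one that `once` had remembered.
    handled-y (again ne) h = _ , _ , ne , pending , h
    handled′ : ∀ u → StatusHandled σ′ u (status′ u)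
    handled′ u with u Fin.≟ y
    ... | yes refl = subst (StatusHandled σ′ y) (sym (updateAt-updates y status))
                       (handled-y ent (StatusHandled-⊑ le y _ (handled (inv cr) y)))
    ... | no u≢y   = subst (StatusHandled σ′ u) (sym (updateAt-minimal u y status u≢y))
                       (StatusHandled-⊑ le u _ (handled (inv cr) u))

  -- The old task may be dropped because its list is exhausted. The new one starts with every edge
  -- by which its vertex can be left, since all of these are incident to it.
  dequeue : ∀ {found status τ queue τ₀} →
    Invariant (state found status (τ ∷ queue) τ₀ []) →
    Invariant (state found status queue τ (incident (proj₁ τ)))
  dequeue {τ = τ} inv with admissibles inv
  ... | adm ∷ adms = record
    { admissible  = adm
    ; admissibles = adms
    ; arrived     = arrived inv
    ; unique!     = unique! inv
    ; rem⊆        = Equivalence.to (complete _ _)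
    ; initially   = Handled-⊑ le (initially inv)
    ; handled     = λ u → StatusHandled-⊑ le u _ (handled inv u)
    }
    where
    le : _ ⊑ _
    le = record
      { served  = id
      ; waiting = λ { τ c p (inj₁ (here refl)) →
                        inj₂ (inj₂ (refl , Equivalence.from (complete _ _) (crosses-incident c)))
                    ; τ c p (inj₁ (there τ∈))  → inj₂ (inj₁ τ∈)
                    ; τ c p (inj₂ (_ , ())) }
      }

  start-state : State
  start-state = state [] (λ _ → fresh) [] (v , only x) (incident v)

  start-invariant : Invariant start-state
  start-invariant = record
    { admissible  = refl , refl
    ; admissibles = []
    ; arrived     = λ ()
    ; unique!     = []
    ; rem⊆        = Equivalence.to (complete _ _)
    ; initially   = λ c _ → inj₂ (inj₂ (refl , Equivalence.from (complete _ _) (crosses-incident c)))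
    ; handled     = λ _ → tt
    }

  -- Correctness at termination

  module _ {found status τ} (inv : Invariant (state found status [] τ [])) where

    private
      σ : State
      σ = state found status [] τ []

      settled : ∀ {τ e} {A : Set} → A ⊎ Waiting σ τ e → A
      settled (inj₁ a)             = a
      settled (inj₂ (inj₁ ()))
      settled (inj₂ (inj₂ (_ , ())))

      -- For `once`, the covered label is the one that the finished task avoids. For `full`, the
      -- label of `e` differs from at least one of two distinct avoided labels, so one of the two
      -- finished tasks has served `e`.
      next-served : ∀ {z l e y} → Covers (status z) l → Crosses G e z y → l ≢ label e → Served σ e y
      next-served {z} {l} {e} cov c ne with status z | handled inv z
      next-served cov c ne | once k | h = settled (h c λ eq → ne (trans cov (sym eq)))
      next-served {e = e} cov c ne | full | l₁ , l₂ , l₁≢l₂ , h₁ , h₂ with label e ℕ.≟ l₁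
      ... | yes refl = settled (h₂ c l₁≢l₂)
      ... | no e≢l₁  = settled (h₁ c e≢l₁)

      tail-found : ∀ {z w e} → Covers (status z) (label e) → (p : Path G z w) →
        Linked (λ e f → label e ≢ label f) (e ∷ edges G p) → ∀ {f} → f ∈ edges G p → f ∈ found
      tail-found cov ((e , c) ◅ p) (ne ∷ l) f∈ with next-served cov c ne | f∈
      ... | e∈ , _   | here refl = e∈
      ... | _ , cov′ | there f∈p = tail-found cov′ p l f∈p

    finish : Identifies (map toℕ found) (OnNonrepetitivePath G v x)
    finish = found , refl , unique! inv , λ e → mk⇔ (arrives⇒onPath ∘ proj₂ ∘ arrived inv) onPath⇒found
      where
      onPath⇒found : ∀ {e} → OnNonrepetitivePath G v x e → e ∈ found
      onPath⇒found (_ , (e , c) ◅ p , np , ip , f∈) with settled (initially inv c (just-injective ip)) | f∈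
      ... | e∈ , _  | here refl = e∈
      ... | _ , cov | there f∈p = tail-found cov p np f∈p

  -- The potential and its linear bound

  cost : Vertex → ℕ
  cost z = suc (length (incident z))

  -- The extra unit in `cost` pays for dequeuing, so that scanning an entry and dequeuing a task
  -- each lower the potential by exactly one.
  potential : State → ℕ
  potential (state _ status queue _ rem) =
    length rem + (sum (map (cost ∘ proj₁) queue) + sum (tabulate λ z → credit (status z) * cost z))

  -- Creating the task moves `cost y` from the credit of `y` to the queue. The drop by one is due to
  -- the entry taken off the current list.
  potential-visitNew : ∀ {found found′ status queue τ e rem y t l s} → Entered (status y) l s →
    potential (state found status queue τ (e ∷ rem)) ≡
    suc (potential (state found′ (updateAt status y (λ _ → s)) (queue ++ (y , t) ∷ []) τ rem))
  potential-visitNew {status = status} {queue} {rem = rem} {y} {t} {s = s} ent =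
    cong suc (cong (length rem +_) (begin
      a + sum (tabulate λ z → credit (status z) * cost z)
        ≡⟨ cong (a +_) (sum-tabulate-update _ (λ z → credit (status′ z) * cost z) y pay same) ⟩
      a + (cost y + b)
        ≡⟨ move a (cost y) b ⟩
      a + (cost y + 0) + b
        ≡⟨ cong (_+ b) (sum-++ (map (cost ∘ proj₁) queue) (cost y ∷ [])) ⟨
      sum (map (cost ∘ proj₁) queue ++ cost y ∷ []) + b
        ≡⟨ cong (λ ys → sum ys + b) (map-++ (cost ∘ proj₁) queue _) ⟨
      sum (map (cost ∘ proj₁) (queue ++ (y , t) ∷ [])) + b ∎))
    where
    open ≡-Reasoning
    status′ = updateAt status y (λ _ → s)
    a = sum (map (cost ∘ proj₁) queue)
    b = sum (tabulate λ z → credit (status′ z) * cost z)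
    move : ∀ a c b → a + (c + b) ≡ a + (c + 0) + b
    move = solve-∀
    entered-credit : ∀ {s₀ l} → Entered s₀ l s → credit s₀ ≡ suc (credit s)
    entered-credit fresh     = refl
    entered-credit (again _) = refl
    pay : credit (status y) * cost y ≡ cost y + credit (status′ y) * cost y
    pay rewrite updateAt-updates y {λ _ → s} status | entered-credit ent = refl
    same : ∀ {w} → w ≢ y → credit (status′ w) * cost w ≡ credit (status w) * cost w
    same {w} w≢y = cong (λ s′ → credit s′ * cost w) (updateAt-minimal w y status w≢y)

  potential-dequeue : ∀ {found status τ queue τ₀} →
    potential (state found status (τ ∷ queue) τ₀ []) ≡
    suc (potential (state found status queue τ (incident (proj₁ τ))))
  potential-dequeue {τ = z , _} {queue} = cong suc (+-assoc (length (incident z)) _ _)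

  -- A side is an edge together with one of its ends, the source coming first.
  side : Vertex → Edge → Fin (m + m)
  side u e with source e Fin.≟ u
  ... | yes _ = e ↑ˡ m
  ... | no  _ = m ↑ʳ e

  left≢right : ∀ e f → e ↑ˡ m ≢ m ↑ʳ f
  left≢right e f eq
    with trans (sym (Fin.splitAt-↑ˡ m e m)) (trans (cong (splitAt m) eq) (Fin.splitAt-↑ʳ m m f))
  ... | ()

  side-edge : ∀ {u w e f} → side u e ≡ side w f → e ≡ f
  side-edge {u} {w} {e} {f} eq with source e Fin.≟ u | source f Fin.≟ w
  ... | yes _ | yes _ = Fin.↑ˡ-injective m e f eq
  ... | no  _ | no  _ = Fin.↑ʳ-injective m e f eq
  ... | yes _ | no  _ = ⊥-elim (left≢right e f eq)
  ... | no  _ | yes _ = ⊥-elim (left≢right f e (sym eq))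

  side-vertex : ∀ {u w e f} → Incident e u → Incident f w → side u e ≡ side w f → u ≡ w
  side-vertex {u} {w} {e} iu iw eq with side-edge {u} {w} eq
  ... | refl with source e Fin.≟ u | source e Fin.≟ w
  ...   | yes p | yes q = trans (sym p) q
  ...   | yes _ | no  _ = ⊥-elim (left≢right e e eq)
  ...   | no  _ | yes _ = ⊥-elim (left≢right e e (sym eq))
  ...   | no  p | no  q with iu | iw
  ...     | inj₁ s | _      = ⊥-elim (p s)
  ...     | _      | inj₁ s = ⊥-elim (q s)
  ...     | inj₂ s | inj₂ t = trans (sym s) t

  -- Every vertex has an incident edge; the sides chosen in this way are distinct, as a side
  -- determines its vertex.
  n≤2m : n ≤ m + m
  n≤2m = Fin.injective⇒≤ {f = λ u → side u (proj₁ (noIsolated u))}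
    (λ {u} {w} → side-vertex (proj₂ (noIsolated u)) (proj₂ (noIsolated w)))

  sides : Vertex → List (Fin (m + m))
  sides u = map (side u) (incident u)

  sides-unique : Unique (concat (tabulate sides))
  sides-unique = Unique.concat⁺
    (All.tabulate⁺ λ u → Unique.map⁺ (side-edge {u} {u}) (unique u))
    (AllPairs.tabulate⁺ disjoint)
    where
    disjoint : ∀ {u w} → u ≢ w → Disjoint (sides u) (sides w)
    disjoint {u} {w} u≢w (i∈ , j∈) with ∈-map⁻ (side u) i∈ | ∈-map⁻ (side w) j∈
    ... | e , e∈ , refl | f , f∈ , eq =
      u≢w (side-vertex (Equivalence.to (complete u e) e∈) (Equivalence.to (complete w f) f∈) eq)

  -- The handshake lemma, as an inequality because a self-loop is listed once and so takes up only
  -- one of its two sides.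
  degree-sum : sum (tabulate (length ∘ incident)) ≤ m + m
  degree-sum = subst (_≤ m + m)
    (trans (length-concat-tabulate sides) (cong sum (tabulate-cong λ u → length-map (side u) (incident u))))
    (unique-length sides-unique)

  cost-sum : sum (tabulate cost) ≤ 4 * m
  cost-sum = subst₂ _≤_ (sym (sum-tabulate-suc (length ∘ incident))) (four m)
    (+-mono-≤ n≤2m degree-sum)
    where
    four : ∀ m → m + m + (m + m) ≡ 4 * m
    four = solve-∀

  -- The initial list has at most `m` entries and is not charged to the credit of `v`. The two tasks
  -- that each vertex may create account for the remaining `2 * (4 * m)`.
  start-potential : potential start-state ≤ 9 * m
  start-potential = subst₂ _≤_
    (cong (length (incident v) +_) (sym (sum-tabulate-* 2 cost)))
    (nine m)
    (+-mono-≤ (unique-length (unique v)) (*-monoʳ-≤ 2 cost-sum))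
    where
    nine : ∀ m → m + 2 * (4 * m) ≡ 9 * m
    nine = solve-∀

-- The program and its simulation of the search

zeroR kindR oneR srcR tgtR labR offR lstR markR stR : Register
zeroR = 0
kindR = 1
oneR  = 2
srcR  = 3
tgtR  = 4
labR  = 5
offR  = 6
lstR  = 7
markR = 8
stR   = 9

-- The current task is encoded by w, want and l; its list is scanned from
-- address i up to j; the queue lies between the addresses qh and qt.
wR wantR lR iR jR qhR qtR : Register
wR    = 10
wantR = 11
lR    = 12
iR    = 13
jR    = 14
qhR   = 15
qtR   = 16

eR bR zR tR sR uR aR nR mR : Register
eR = 17
bR = 18
zR = 19
tR = 20
sR = 21
uR = 22
aR = 23
nR = 24
mR = 25

P : Program
P =
  const oneR 1 ∷
  load kindR zeroR ∷
  load nR oneR ∷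
  const tR 2 ∷
  load mR tR ∷
  const tR 3 ∷
  load wR tR ∷
  const tR 4 ∷
  load lR tR ∷
  const srcR 5 ∷
  add tgtR srcR mR ∷
  add labR tgtR mR ∷
  add offR labR mR ∷
  add tR offR nR ∷
  load sR tR ∷
  add lstR tR oneR ∷
  add markR lstR sR ∷
  add stR markR mR ∷
  add qhR stR nR ∷
  add qtR stR nR ∷
  const wantR 1 ∷
  -- 21: point i and j to the ends of the incidence list of w
  add tR offR wR ∷
  load iR tR ∷
  add tR tR oneR ∷
  load jR tR ∷
  add iR lstR iR ∷
  add jR lstR jR ∷
  -- 27: main loop
  sub tR jR iR ∷
  jumpZ tR 78 ∷
  -- 29: next edge e, with label b; is it allowed by the test?
  load eR iR ∷
  add iR iR oneR ∷
  add tR labR eR ∷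
  load bR tR ∷
  sub tR bR lR ∷
  sub sR lR bR ∷
  add tR tR sR ∷
  sub tR oneR tR ∷
  sub sR tR wantR ∷
  sub tR wantR tR ∷
  add tR tR sR ∷
  jumpZ tR 42 ∷
  jump 27 ∷
  -- 42: z becomes the other end of e
  add tR srcR eR ∷
  load sR tR ∷
  add tR tgtR eR ∷
  load zR tR ∷
  sub tR sR wR ∷
  sub uR wR sR ∷
  add tR tR uR ∷
  jumpZ tR 52 ∷
  jumpZ kindR 27 ∷
  add zR sR zeroR ∷
  -- 52: emit e unless it is marked
  add tR markR eR ∷
  load sR tR ∷
  jumpZ sR 56 ∷
  jump 58 ∷
  store tR oneR ∷
  emit eR ∷
  -- 58: enter z by label b
  add tR stR zR ∷
  load aR tR ∷
  jumpZ aR 70 ∷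
  sub sR aR oneR ∷
  jumpZ sR 27 ∷
  sub sR sR oneR ∷
  sub uR sR bR ∷
  sub sR bR sR ∷
  add sR sR uR ∷
  jumpZ sR 27 ∷
  store tR oneR ∷
  jump 73 ∷
  -- 70: first entry
  add sR bR oneR ∷
  add sR sR oneR ∷
  store tR sR ∷
  -- 73: enqueue
  store qtR zR ∷
  add qtR qtR oneR ∷
  store qtR bR ∷
  add qtR qtR oneR ∷
  jump 27 ∷
  -- 78: dequeue
  sub tR qtR qhR ∷
  jumpZ tR 86 ∷
  load wR qhR ∷
  add qhR qhR oneR ∷
  load lR qhR ∷
  add qhR qhR oneR ∷
  const wantR 0 ∷
  jump 21 ∷
  halt ∷ []

-- The absolute difference. It turns equality into a test for zero, the only one that the machine
-- offers.
dist : ℕ → ℕ → ℕ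
dist a b = (a ∸ b) + (b ∸ a)

dist-≡ : ∀ {a b} → a ≡ b → dist a b ≡ 0
dist-≡ {a} refl = cong₂ _+_ (n∸n≡0 a) (n∸n≡0 a)

dist-≢ : ∀ {a b} → a ≢ b → dist a b ≢ 0
dist-≢ {a} {b} a≢b eq = a≢b (≤-antisym
  (m∸n≡0⇒m≤n (m+n≡0⇒m≡0 (a ∸ b) eq)) (m∸n≡0⇒m≤n (m+n≡0⇒n≡0 (a ∸ b) eq)))

wanted testLabel : Test → ℕ
wanted (only _)  = 1
wanted (avoid _) = 0
testLabel (only l)  = l
testLabel (avoid l) = l

passes? : ∀ t b → Dec (Passes t b)
passes? (only l)  b = b ℕ.≟ l
passes? (avoid l) b = ¬? (b ℕ.≟ l)

-- 1 ∸ dist b l is the truth value of b ≡ l, which is compared with the wanted one.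
verdict : ℕ → ℕ → ℕ → ℕ → ℕ
verdict want l one b = dist want (one ∸ dist b l)

verdict-pass : ∀ t {b want l one c} → want ≡ wanted t → l ≡ testLabel t → one ≡ 1 → c ≡ b →
  Passes t b → verdict want l one c ≡ 0
verdict-pass (only l) {b} refl refl refl refl p rewrite dist-≡ p = refl
verdict-pass (avoid l) {b} refl refl refl refl p with dist b l | dist-≢ p
... | zero  | d≢0 = ⊥-elim (d≢0 refl)
... | suc d | _   rewrite 0∸n≡0 d = refl

verdict-fail : ∀ t {b want l one c} → want ≡ wanted t → l ≡ testLabel t → one ≡ 1 → c ≡ b →
  ¬ Passes t b → verdict want l one c ≢ 0
verdict-fail (only l) {b} refl refl refl refl ¬p with dist b l | dist-≢ ¬p
... | zero  | d≢0 = ⊥-elim (d≢0 refl)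
... | suc d | _   rewrite 0∸n≡0 d = λ ()
verdict-fail (avoid l) {b} refl refl refl refl ¬p with b ℕ.≟ l
... | yes b≡l rewrite dist-≡ b≡l = λ ()
... | no  b≢l = ⊥-elim (¬p b≢l)

-- Zero must mean `fresh`, since untouched memory is zero. The shift by two keeps all labels,
-- including 0, apart from the other codes.
code : Status → ℕ
code fresh    = 0
code full     = 1
code (once l) = 2 + l

at : ∀ k {xs ys} → xs ≡ ys → contents xs k ≡ contents ys k
at k = cong (λ xs → contents xs k)

segment-split-tabulate : ∀ {f i n} (g : Fin n → ℕ) {zs j} → Segment f i (tabulate g ++ zs) j →
  Segment f i (tabulate g) (i + n) × Segment f (i + n) zs j
segment-split-tabulate g s = subst (λ k → Segment _ _ (tabulate g) (_ + k) × Segment _ (_ + k) _ _)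
  (length-tabulate g) (segment-split (tabulate g) s)

concat-tabulate-split : ∀ {A : Set} {n} (f : Fin n → List A) u → ∃[ rest ]
  concat (tabulate f) ≡ concat (take (toℕ u) (tabulate f)) ++ f u ++ rest
concat-tabulate-split f zero    = concat (tabulate (f ∘ suc)) , refl
concat-tabulate-split f (suc u) =
  let rest , eq = concat-tabulate-split (f ∘ suc) u
  in rest , trans (cong (f zero ++_) eq) (sym (++-assoc (f zero) _ _))

length-concat-take-suc : ∀ {A : Set} {n} (f : Fin n → List A) u →
  length (concat (take (suc (toℕ u)) (tabulate f))) ≡
  length (concat (take (toℕ u) (tabulate f))) + length (f u)
length-concat-take-suc f zero    = trans (length-++ (f zero)) (+-comm (length (f zero)) 0)
length-concat-take-suc f (suc u) = begin
  length (f zero ++ concat (take (suc (toℕ u)) fs))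
    ≡⟨ length-++ (f zero) ⟩
  length (f zero) + length (concat (take (suc (toℕ u)) fs))
    ≡⟨ cong (length (f zero) +_) (length-concat-take-suc (f ∘ suc) u) ⟩
  length (f zero) + (length (concat (take (toℕ u) fs)) + length (f (suc u)))
    ≡⟨ +-assoc (length (f zero)) _ _ ⟨
  length (f zero) + length (concat (take (toℕ u) fs)) + length (f (suc u))
    ≡⟨ cong (_+ length (f (suc u))) (length-++ (f zero)) ⟨
  length (f zero ++ concat (take (toℕ u) fs)) + length (f (suc u)) ∎
  where
  open ≡-Reasoning
  fs = tabulate (f ∘ suc)

-- Memory layout and representation of states

module Simulation (G : Graph) (I : IncidenceLists G) (v : Graph.Vertex G) (x : ℕ) where
  open Graph G
  open IncidenceLists I
  open Search G I v x

  ws : List ℕ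
  ws = encode G I v x

  -- Beyond the input, which ends at markA, the memory holds an array of marks
  -- of emitted edges, an array of statuses, and the ever growing queue.
  tgtA labA offA lstA markA stA queueA : Address
  tgtA   = 5 + m
  labA   = tgtA + m
  offA   = labA + m
  lstA   = offA + suc n
  markA  = lstA + start n
  stA    = markA + m
  queueA = stA + n

  record Input (μ : Address → ℕ) (j : Address) : Set where
    field
      sources  : ∀ e → μ (5 + toℕ e) ≡ toℕ (source e)
      targets  : ∀ e → μ (tgtA + toℕ e) ≡ toℕ (target e)
      labels   : ∀ e → μ (labA + toℕ e) ≡ label e
      starts   : ∀ (u : Fin (suc n)) → μ (offA + toℕ u) ≡ start (toℕ u)
      incLists : Segment μ lstA (map toℕ (concat lists)) j

  input : ∀ {μ j} → Segment μ 0 ws j → Input μ j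
  input (_ , _ , _ , _ , _ , s) = record
    { sources  = segment-lookup _ (proj₁ s₁)
    ; targets  = segment-lookup _ (proj₁ s₂)
    ; labels   = segment-lookup _ (proj₁ s₃)
    ; starts   = segment-lookup _ (proj₁ s₄)
    ; incLists = proj₂ s₄
    }
    where
    s₁ = segment-split-tabulate (λ e → toℕ (source e)) s
    s₂ = segment-split-tabulate (λ e → toℕ (target e)) (proj₂ s₁)
    s₃ = segment-split-tabulate label (proj₂ s₂)
    s₄ = segment-split-tabulate {n = suc n} (λ u → start (toℕ u)) (proj₂ s₃)

  start-n : start n ≡ length (concat lists)
  start-n = cong (length ∘ concat) (take-all n lists (≤-reflexive (length-tabulate incident)))

  length-ws : length ws ≡ markA
  length-ws = begin
    length ws                      ≡⟨ segment-end _ ((Input.incLists (input (segment-contents ws)))) ⟨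
    _                              ≡⟨ cong (lstA +_) (length-map toℕ (concat lists)) ⟩
    lstA + length (concat lists)   ≡⟨ cong (lstA +_) start-n ⟨
    markA                          ∎
    where open ≡-Reasoning

  incidenceList : ∀ {μ} → Input μ markA → ∀ u →
    Segment μ (lstA + start (toℕ u)) (map toℕ (incident u)) (lstA + start (suc (toℕ u))) ×
    lstA + start (suc (toℕ u)) ≤ markA
  incidenceList {μ} inp u = subst (Segment μ i es) end (proj₁ s₂) ,
    subst (_≤ markA) end (segment-≤ (map toℕ rest) (proj₂ s₂))
    where
    pre  = concat (take (toℕ u) lists)
    rest = proj₁ (concat-tabulate-split incident u)
    es   = map toℕ (incident u)
    i    = lstA + start (toℕ u)
    parts : map toℕ (concat lists) ≡ map toℕ pre ++ es ++ map toℕ rest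
    parts = trans (cong (map toℕ) (proj₂ (concat-tabulate-split incident u)))
      (trans (map-++ toℕ pre _) (cong (map toℕ pre ++_) (map-++ toℕ (incident u) rest)))
    s₁ : Segment μ i (es ++ map toℕ rest) markA
    s₁ = subst (λ k → Segment μ (lstA + k) (es ++ map toℕ rest) markA) (length-map toℕ pre)
      (proj₂ (segment-split (map toℕ pre) (subst (λ ys → Segment μ lstA ys markA) parts (Input.incLists inp))))
    s₂ = segment-split es s₁
    end : i + length es ≡ lstA + start (suc (toℕ u))
    end = trans (cong (i +_) (length-map toℕ (incident u)))
      (trans (+-assoc lstA _ _) (cong (lstA +_) (sym (length-concat-take-suc incident u))))

  constants : List ℕ
  constants = 0 ∷ kindCode kind ∷ 1 ∷ 5 ∷ tgtA ∷ labA ∷ offA ∷ lstA ∷ markA ∷ stA ∷ []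

  taskWords : Task → List ℕ
  taskWords (z , t) = toℕ z ∷ testLabel t ∷ []

  Marks : List Edge → (Edge → ℕ) → Set
  Marks found mk = ∀ e → (mk e ≡ 0 × e ∉ found) ⊎ (mk e ≡ 1 × e ∈ found)

  record Represents′ (constants′ : List ℕ) (w want l i j qh qt : ℕ)
                     (μ : Address → ℕ) (σ : State) : Set where
    open State σ
    field
      constants≡ : constants′ ≡ constants
      w≡         : w ≡ toℕ (proj₁ task)
      want≡      : want ≡ wanted (proj₂ task)
      l≡         : l ≡ testLabel (proj₂ task)
      remAt      : Segment μ i (map toℕ rem) j
      j≤markA    : j ≤ markA
      inputAt    : Segment μ 0 ws markA
      mark       : Edge → ℕ
      markAt     : Segment μ markA (tabulate mark) stA
      marks      : Marks found mark
      statusAt   : Segment μ stA (tabulate (code ∘ status)) queueA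
      queueA≤qh  : queueA ≤ qh
      queueAt    : Segment μ qh (concatMap taskWords queue) qt
      -- The queue stores a vertex and a label but not the kind of test, so dequeuing can set `want`
      -- to 0 outright.
      avoiding   : All (λ τ → 0 ≡ wanted (proj₂ τ)) queue

  -- The registers enter only through their values, so that a representation
  -- is carried along unchanged when other registers are overwritten.
  Represents : (Register → ℕ) → (Address → ℕ) → State → Set
  Represents ρ = Represents′ (map ρ (upTo 10)) (ρ wR) (ρ wantR) (ρ lR) (ρ iR) (ρ jR) (ρ qhR) (ρ qtR)

  Goal : ℕ → Config → Set
  Goal = HaltsWithin P (λ o → Identifies o (OnNonrepetitivePath G v x))

  -- The induction hypothesis of `loop`, abstracted so that the inner blocks, which all return to
  -- the head of the main loop, can be verified beforehand.
  Continues : ℕ → ℕ → Set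
  Continues T φ = ∀ σ → Invariant σ → potential σ ≤ φ → ∀ ρ μ → Represents ρ μ σ →
    Goal T (config 27 ρ μ (map toℕ (State.found σ)))

  -- Simulation of the program, block by block

  scan : ∀ {T found status queue z t} ρ μ {o} →
    Represents ρ μ (state found status queue (z , t) []) →
    (∀ ρ → Represents ρ μ (state found status queue (z , t) (incident z)) → Goal T (config 27 ρ μ o)) →
    Goal (6 + T) (config 21 ρ μ o)
  scan {z = z} ρ μ R k = runTo P 6 27 (config 21 ρ μ _) refl (k _ record
    { constants≡ = constants≡
    ; w≡         = w≡
    ; want≡      = want≡
    ; l≡         = l≡
    ; remAt      = subst₂ (λ i j → Segment μ i (map toℕ (incident z)) j) (sym i≡) (sym j≡)
                     (proj₁ (incidenceList inp z))
    ; j≤markA    = subst (_≤ markA) (sym j≡) (proj₂ (incidenceList inp z))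
    ; inputAt    = inputAt
    ; mark       = mark
    ; markAt     = markAt
    ; marks      = marks
    ; statusAt   = statusAt
    ; queueA≤qh  = queueA≤qh
    ; queueAt    = queueAt
    ; avoiding   = avoiding
    })
    where
    open Represents′ R
    inp = input inputAt
    -- The array of starts has `n + 1` entries, so that `inject₁ z` and `suc z` both index it, also
    -- for the last vertex.
    entry : μ (ρ offR + ρ wR) ≡ start (toℕ z)
    entry = trans (cong μ (cong₂ _+_ (at 6 constants≡) (trans w≡ (sym (Fin.toℕ-inject₁ z)))))
      (trans (Input.starts inp (inject₁ z)) (cong start (Fin.toℕ-inject₁ z)))
    entry′ : μ (ρ offR + ρ wR + ρ oneR) ≡ start (suc (toℕ z))
    entry′ = trans (cong μ (trans (cong₂ _+_ (cong₂ _+_ (at 6 constants≡) w≡) (at 2 constants≡))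
      (trans (+-assoc offA (toℕ z) 1) (cong (offA +_) (+-comm (toℕ z) 1)))))
      (Input.starts inp (suc z))
    i≡ : ρ lstR + μ (ρ offR + ρ wR) ≡ lstA + start (toℕ z)
    i≡ = cong₂ _+_ (at 7 constants≡) entry
    j≡ : ρ lstR + μ (ρ offR + ρ wR + ρ oneR) ≡ lstA + start (suc (toℕ z))
    j≡ = cong₂ _+_ (at 7 constants≡) entry′

  markA≤stA : markA ≤ stA
  markA≤stA = m≤m+n markA m

  stA≤queueA : stA ≤ queueA
  stA≤queueA = m≤m+n stA n

  markA≤queueA : markA ≤ queueA
  markA≤queueA = ≤-trans markA≤stA stA≤queueA

  enqueue : ∀ {T found status queue τ rem y b} ρ μ {o} →
    Represents ρ μ (state found status queue τ rem) → ρ zR ≡ toℕ y → ρ bR ≡ b →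
    (∀ ρ μ → Represents ρ μ (state found status (queue ++ (y , avoid b) ∷ []) τ rem) →
      Goal T (config 27 ρ μ o)) →
    Goal (5 + T) (config 73 ρ μ o)
  enqueue {queue = queue} {rem = rem} {y} {b} ρ μ R z≡ b≡ k =
    runTo P 5 27 (config 73 ρ μ _) refl (k _ _ record
      { constants≡ = constants≡
      ; w≡         = w≡
      ; want≡      = want≡
      ; l≡         = l≡
      ; remAt      = frame (map toℕ rem) (≤-trans j≤markA markA≤queueA) remAt
      ; j≤markA    = j≤markA
      ; inputAt    = frame ws markA≤queueA inputAt
      ; mark       = mark
      ; markAt     = frame _ stA≤queueA markAt
      ; marks      = marks
      ; statusAt   = frame _ ≤-refl statusAt
      ; queueA≤qh  = queueA≤qh
      ; queueAt    = subst (λ ys → Segment μ″ (ρ qhR) ys (q′ + ρ oneR))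
                       (sym (concatMap-++ taskWords queue ((y , avoid b) ∷ [])))
                       (segment-++ (concatMap taskWords queue)
                         (frame₂ (concatMap taskWords queue) ≤-refl queueAt) new)
      ; avoiding   = All.++⁺ avoiding (refl ∷ [])
      })
    where
    open Represents′ R
    q  = ρ qtR
    q′ = q + ρ oneR
    μ″ = (μ [ q ≔ ρ zR ]) [ q′ ≔ ρ bR ]
    queueA≤q : queueA ≤ q
    queueA≤q = ≤-trans queueA≤qh (segment-≤ _ queueAt)
    frame₂ : ∀ {i} ys {j} → j ≤ q → Segment μ i ys j → Segment μ″ i ys j
    frame₂ ys j≤q = segment-frame ys (inj₂ (≤-trans j≤q (m≤m+n q _))) ∘ segment-frame ys (inj₂ j≤q)
    frame : ∀ {i} ys {j} → j ≤ queueA → Segment μ i ys j → Segment μ″ i ys j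
    frame ys j≤ = frame₂ ys (≤-trans j≤ queueA≤q)
    one≡ : ρ oneR ≡ 1
    one≡ = at 2 constants≡
    q′≡ : suc q ≡ q′
    q′≡ = trans (+-comm 1 q) (cong (q +_) (sym one≡))
    new : Segment μ″ q (toℕ y ∷ b ∷ []) (q′ + ρ oneR)
    new = trans (update-other (μ [ q ≔ ρ zR ]) (<⇒≢ (≤-reflexive q′≡)))
                (trans (update-same μ q) z≡) ,
          trans (cong μ″ q′≡) (trans (update-same (μ [ q ≔ ρ zR ]) q′) b≡) ,
          trans (cong suc q′≡) (trans (+-comm 1 q′) (cong (q′ +_) (sym one≡)))

  setStatus : ∀ ρ μ {found status queue τ rem} y s {a c} →
    a ≡ stA + toℕ y → c ≡ code s →
    Represents ρ μ (state found status queue τ rem) →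
    Represents ρ (μ [ a ≔ c ]) (state found (updateAt status y (λ _ → s)) queue τ rem)
  setStatus ρ μ {status = status} {queue} {rem = rem} y s refl refl R = record
    { constants≡ = constants≡
    ; w≡         = w≡
    ; want≡      = want≡
    ; l≡         = l≡
    ; remAt      = segment-frame (map toℕ rem) (inj₂ (≤-trans j≤markA markA≤a)) remAt
    ; j≤markA    = j≤markA
    ; inputAt    = segment-frame ws (inj₂ markA≤a) inputAt
    ; mark       = mark
    ; markAt     = segment-frame _ (inj₂ (m≤m+n stA (toℕ y))) markAt
    ; marks      = marks
    ; statusAt   = segment-write (code ∘ status) _ y
                     (cong code (updateAt-updates y status))
                     (λ w≢y → cong code (updateAt-minimal _ y status w≢y)) statusAt
    ; queueA≤qh  = queueA≤qh
    ; queueAt    = segment-frame (concatMap taskWords queue)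
                     (inj₁ (<-≤-trans (+-monoʳ-< stA (Fin.toℕ<n y)) queueA≤qh)) queueAt
    ; avoiding   = avoiding
    }
    where
    open Represents′ R
    markA≤a : markA ≤ stA + toℕ y
    markA≤a = ≤-trans markA≤stA (m≤m+n stA (toℕ y))

  setMark : ∀ ρ μ {found status queue τ rem} e {a c} →
    a ≡ markA + toℕ e → c ≡ 1 →
    Represents ρ μ (state found status queue τ rem) →
    Represents ρ (μ [ a ≔ c ]) (state (found ++ e ∷ []) status queue τ rem)
  setMark ρ μ {found} {queue = queue} {rem = rem} e refl refl R = record
    { constants≡ = constants≡
    ; w≡         = w≡
    ; want≡      = want≡
    ; l≡         = l≡
    ; remAt      = segment-frame (map toℕ rem) (inj₂ (≤-trans j≤markA (m≤m+n markA (toℕ e)))) remAt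
    ; j≤markA    = j≤markA
    ; inputAt    = segment-frame ws (inj₂ (m≤m+n markA (toℕ e))) inputAt
    ; mark       = mark′
    ; markAt     = segment-write mark mark′ e (updateAt-updates e mark)
                     (λ f≢e → updateAt-minimal _ e mark f≢e) markAt
    ; marks      = marks′
    ; statusAt   = segment-frame _ (inj₁ a<stA) statusAt
    ; queueA≤qh  = queueA≤qh
    ; queueAt    = segment-frame (concatMap taskWords queue)
                     (inj₁ (<-≤-trans a<stA (≤-trans stA≤queueA queueA≤qh))) queueAt
    ; avoiding   = avoiding
    }
    where
    open Represents′ R
    a<stA : markA + toℕ e < stA
    a<stA = +-monoʳ-< markA (Fin.toℕ<n e)
    mark′ = updateAt mark e (λ _ → 1)
    marks′ : Marks (found ++ e ∷ []) mark′
    marks′ f with f Fin.≟ e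
    ... | yes refl = inj₂ (updateAt-updates e mark , ∈-++⁺ʳ found (here refl))
    ... | no f≢e rewrite updateAt-minimal f e {λ _ → 1} mark f≢e with marks f
    ...   | inj₂ (eq , f∈) = inj₂ (eq , ∈-++⁺ˡ f∈)
    ...   | inj₁ (eq , f∉) = inj₁ (eq , λ f∈ → absent (∈-++⁻ found f∈))
      where
      absent : ¬ (f ∈ found ⊎ f ∈ e ∷ [])
      absent (inj₁ f∈)         = f∉ f∈
      absent (inj₂ (here f≡e)) = f≢e f≡e

  open Crossing

  -- The program has already moved `i` past `e`, so the representation lists `rem` while the
  -- invariant still lists `e ∷ rem`. The longest branch, entry by a second label, takes 3 + 2 + 5 +
  -- 2 + 5 = 17 steps; the others are padded.
  visit : ∀ {T φ found status queue z t e rem y} → Continues T φ →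
    Crossing found status queue z t e rem y → e ∈ found →
    potential (state found status queue (z , t) (e ∷ rem)) ≤ suc φ →
    ∀ ρ μ → Represents ρ μ (state found status queue (z , t) rem) →
    ρ zR ≡ toℕ y → ρ bR ≡ label e →
    Goal (17 + T) (config 58 ρ μ (map toℕ found))
  visit {T} {φ} {found} {status} {queue} {z} {t} {e} {rem} {y} continue cr e∈ (s≤s bound) ρ μ R z≡ b≡ = body (status y) refl
    where
    open Represents′ R
    one≡ : ρ oneR ≡ 1
    one≡ = at 2 constants≡
    address : ρ stR + ρ zR ≡ stA + toℕ y
    address = cong₂ _+_ (at 9 constants≡) z≡
    read : μ (ρ stR + ρ zR) ≡ code (status y)
    read = trans (cong μ address) (segment-lookup (code ∘ status) statusAt y)
    covered : ∀ ρ → Represents ρ μ (state found status queue (z , t) rem) →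
      Covers (status y) (label e) → Goal T (config 27 ρ μ (map toℕ found))
    covered ρ R cov = continue _ (visitCovered cr e∈ cov) bound ρ μ R
    entered : ∀ {s} → Entered (status y) (label e) s → ∀ ρ μ →
      Represents ρ μ (state found (updateAt status y (λ _ → s)) queue (z , t) rem) →
      ρ zR ≡ toℕ y → ρ bR ≡ label e → Goal (5 + T) (config 73 ρ μ (map toℕ found))
    entered ent ρ μ R z≡ b≡ = enqueue ρ μ R z≡ b≡ (continue _ (visitNew cr e∈ ent)
      (s≤s⁻¹ (subst (_≤ suc φ) (potential-visitNew {found} {found} {status} {queue} {z , t} {e} {rem} {y} {avoid (label e)} ent) (s≤s bound))))
    body : ∀ s → status y ≡ s → Goal (17 + T) (config 58 ρ μ (map toℕ found))
    body fresh eq =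
      weaken P (m≤n+m (11 + T) 6)
      (runTo P 3 70 (config 58 ρ μ _) (if-zero (trans read (cong code eq)))
      (runTo P 3 73 (config 70 ρ₁ μ _) refl
      (entered ent _ _ (setStatus ρ₂ μ y (once (label e)) address label≡ R) z≡ b≡)))
      where
      ρ₁ = Config.regs (run P 3 (config 58 ρ μ (map toℕ found)))
      ρ₂ = Config.regs (run P 3 (config 70 ρ₁ μ (map toℕ found)))
      label≡ : ρ bR + ρ oneR + ρ oneR ≡ 2 + label e
      label≡ = trans (cong₂ _+_ (cong₂ _+_ b≡ one≡) one≡)
        (trans (+-assoc (label e) 1 1) (+-comm (label e) 2))
      ent : Entered (status y) (label e) (once (label e))
      ent = subst (λ s → Entered s _ _) (sym eq) fresh
    body full eq =
      weaken P (m≤n+m (5 + T) 12)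
      (runTo P 3 61 (config 58 ρ μ _) (if-nonzero (λ a≡0 → 1+n≢0 (trans (sym read′) a≡0)))
      (runTo P 2 27 (config 61 ρ₁ μ _) (if-zero (cong₂ _∸_ read′ one≡))
      (covered _ R (subst (λ s → Covers s (label e)) (sym eq) _))))
      where
      ρ₁ = Config.regs (run P 3 (config 58 ρ μ (map toℕ found)))
      read′ : μ (ρ stR + ρ zR) ≡ 1
      read′ = trans read (cong code eq)
    body (once k) eq =
      runTo P 3 61 (config 58 ρ μ _) (if-nonzero (λ a≡0 → 1+n≢0 (trans (sym read′) a≡0)))
      (runTo P 2 63 (config 61 ρ₁ μ _) (if-nonzero (λ s≡0 → 1+n≢0 (trans (sym s₁≡) s≡0)))
      (compare (label e ℕ.≟ k)))
      where
      ρ₁ = Config.regs (run P 3 (config 58 ρ μ (map toℕ found)))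
      ρ₂ = Config.regs (run P 2 (config 61 ρ₁ μ (map toℕ found)))
      ρ₃ = Config.regs (run P 5 (config 63 ρ₂ μ (map toℕ found)))
      read′ : μ (ρ stR + ρ zR) ≡ 2 + k
      read′ = trans read (cong code eq)
      s₁≡ : μ (ρ stR + ρ zR) ∸ ρ oneR ≡ 1 + k
      s₁≡ = cong₂ _∸_ read′ one≡
      d≡ : ρ₃ sR ≡ dist (label e) k
      d≡ = cong₂ (λ s b → (b ∸ s) + (s ∸ b)) (cong₂ _∸_ s₁≡ one≡) b≡
      compare : Dec (label e ≡ k) → Goal (12 + T) (config 63 ρ₂ μ (map toℕ found))
      compare (yes same) =
        weaken P (m≤n+m (5 + T) 7)
        (runTo P 5 27 (config 63 ρ₂ μ _) (if-zero (trans d≡ (dist-≡ same)))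
        (covered _ R (subst (λ s → Covers s (label e)) (sym eq) same)))
      compare (no differ) =
        runTo P 5 68 (config 63 ρ₂ μ _) (if-nonzero (λ s≡0 → dist-≢ differ (trans (sym d≡) s≡0)))
        (runTo P 2 73 (config 68 ρ₃ μ _) refl
        (entered ent _ _ (setStatus ρ₃ μ y full address one≡ R) z≡ b≡))
        where
        ent : Entered (status y) (label e) full
        ent = subst (λ s → Entered s _ _) (sym eq) (again differ)

  -- An edge may be crossed several times, by both tasks of one end and, if undirected, from either
  -- end. The marks ensure a single emission, at a cost of at most 5 steps before `visit`.
  visitAfterEmit : ∀ {T φ found status queue z t e rem y} → Continues T φ →
    Crossing found status queue z t e rem y →
    potential (state found status queue (z , t) (e ∷ rem)) ≤ suc φ →
    ∀ ρ μ → Represents ρ μ (state found status queue (z , t) rem) →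
    ρ eR ≡ toℕ e → ρ zR ≡ toℕ y → ρ bR ≡ label e →
    Goal (22 + T) (config 52 ρ μ (map toℕ found))
  visitAfterEmit {T} {found = found} {e = e} continue cr bound ρ μ R e≡ z≡ b≡ = body (marks e)
    where
    open Represents′ R
    ρ₁ = Config.regs (run P 3 (config 52 ρ μ (map toℕ found)))
    address : ρ markR + ρ eR ≡ markA + toℕ e
    address = cong₂ _+_ (at 8 constants≡) e≡
    read : μ (ρ markR + ρ eR) ≡ mark e
    read = trans (cong μ address) (segment-lookup mark markAt e)
    output≡ : map toℕ (found ++ e ∷ []) ≡ map toℕ found ++ ρ₁ eR ∷ []
    output≡ = trans (map-++ toℕ found (e ∷ [])) (cong (λ w → map toℕ found ++ w ∷ []) (sym e≡))
    body : (mark e ≡ 0 × e ∉ found) ⊎ (mark e ≡ 1 × e ∈ found) →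
      Goal (22 + T) (config 52 ρ μ (map toℕ found))
    body (inj₁ (unmarked , e∉)) =
      runTo P 3 56 (config 52 ρ μ _) (if-zero (trans read unmarked))
      (runTo P 2 58 (config 56 ρ₁ μ _) refl
      (subst (λ o → Goal (17 + T) (config 58 ρ₁ _ o)) output≡
      (visit continue (emitNew cr e∉) (∈-++⁺ʳ found (here refl)) bound ρ₁ _
        (setMark ρ₁ μ e address (at 2 constants≡) R) z≡ b≡)))
    body (inj₂ (marked , e∈)) =
      weaken P (m≤n+m (21 + T) 1)
      (runTo P 3 55 (config 52 ρ μ _) (if-nonzero λ s≡0 → 1+n≢0 (trans (sym (trans read marked)) s≡0))
      (runTo P 1 58 (config 55 ρ₁ μ _) refl
      (visit continue cr e∈ bound ρ₁ μ R z≡ b≡)))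

  -- Leaving through the source costs 8 steps before the 22 of `visitAfterEmit`; leaving an
  -- undirected edge through its target needs 1 + 1 more, for the check of the kind and the change
  -- of `z`.
  cross : ∀ {T φ found status queue z t e rem} → Continues T φ →
    Invariant (state found status queue (z , t) (e ∷ rem)) → Passes t (label e) →
    potential (state found status queue (z , t) (e ∷ rem)) ≤ suc φ →
    ∀ ρ μ → Represents ρ μ (state found status queue (z , t) rem) →
    ρ eR ≡ toℕ e → ρ bR ≡ label e →
    Goal (32 + T) (config 42 ρ μ (map toℕ found))
  cross {T} {φ} {found} {status} {queue} {z} {t} {e} {rem} continue inv passes bound ρ μ R e≡ b≡ =
    body (source e Fin.≟ z)
    where
    open Represents′ R
    inp = input inputAt
    o = map toℕ found
    ρ₁ = Config.regs (run P 8 (config 42 ρ μ o))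
    ρ₂ = Config.regs (run P 1 (config 50 ρ₁ μ o))
    ρ₃ = Config.regs (run P 1 (config 51 ρ₂ μ o))
    source≡ : ρ₁ sR ≡ toℕ (source e)
    source≡ = trans (cong μ (cong₂ _+_ (at 3 constants≡) e≡)) (Input.sources inp e)
    target≡ : ρ₁ zR ≡ toℕ (target e)
    target≡ = trans (cong μ (cong₂ _+_ (at 4 constants≡) e≡)) (Input.targets inp e)
    d≡ : ρ₁ tR ≡ dist (toℕ (source e)) (toℕ z)
    d≡ = cong₂ dist source≡ w≡
    d≢0 : source e ≢ z → ρ₁ tR ≢ 0
    d≢0 s≢z d≡0 = dist-≢ (s≢z ∘ Fin.toℕ-injective) (trans (sym d≡) d≡0)
    -- The program compares only the source with the current vertex; that `e` comes from the
    -- incidence list of `z` settles the target.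
    target≡z : source e ≢ z → target e ≡ z
    target≡z s≢z with Invariant.rem⊆ inv (here refl)
    ... | inj₁ s≡z = ⊥-elim (s≢z s≡z)
    ... | inj₂ t≡z = t≡z
    only-target : ∀ {u y} → source e ≡ u → Crosses G e u y → y ≡ target e
    only-target _   forward      = refl
    only-target s≡t (backward _) = s≡t
    only-source : ∀ {u y} → source e ≢ u → Crosses G e u y → y ≡ source e
    only-source s≢s forward      = ⊥-elim (s≢s refl)
    only-source _   (backward _) = refl
    directed-blocks : ∀ {u y} → kind ≡ directed → source e ≢ u → ¬ Crosses G e u y
    directed-blocks _  s≢s forward       = s≢s refl
    directed-blocks kd _   (backward ku) with trans (sym kd) ku
    ... | ()
    byKind : ∀ k → kind ≡ k → source e ≢ z → Goal (24 + T) (config 50 ρ₁ μ o)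
    byKind directed kd s≢z =
      weaken P (m≤n+m (1 + T) 23)
      (runTo P 1 27 (config 50 ρ₁ μ o) (if-zero (trans (at 1 constants≡) (cong kindCode kd)))
      (continue _ (skip inv λ c _ → directed-blocks kd s≢z c) (s≤s⁻¹ bound)
        (Config.regs (run P 1 (config 50 ρ₁ μ o))) μ R))
    byKind undirected ku s≢z =
      runTo P 1 51 (config 50 ρ₁ μ o) (if-nonzero λ k≡0 → 1+n≢0 (trans (sym kind≡1) k≡0))
      (runTo P 1 52 (config 51 ρ₂ μ o) refl
      (visitAfterEmit continue cr bound ρ₃ μ R e≡ z≡ b≡))
      where
      kind≡1 : ρ kindR ≡ 1
      kind≡1 = trans (at 1 constants≡) (cong kindCode ku)
      z≡ : ρ₃ zR ≡ toℕ (source e)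
      z≡ = trans (cong₂ _+_ source≡ (at 0 constants≡)) (+-identityʳ _)
      cr : Crossing found status queue z t e rem (source e)
      cr = record
        { inv     = inv
        ; crosses = subst (λ u → Crosses G e u (source e)) (target≡z s≢z) (backward ku)
        ; only-y  = only-source s≢z
        ; passes  = passes
        }
    body : Dec (source e ≡ z) → Goal (32 + T) (config 42 ρ μ o)
    body (yes s≡z) =
      weaken P (m≤n+m (30 + T) 2)
      (runTo P 8 52 (config 42 ρ μ o) (if-zero (trans d≡ (dist-≡ (cong toℕ s≡z))))
      (visitAfterEmit continue cr bound ρ₁ μ R e≡ target≡ b≡))
      where
      cr : Crossing found status queue z t e rem (target e)
      cr = record
        { inv     = inv
        ; crosses = subst (λ u → Crosses G e u (target e)) s≡z forward
        ; only-y  = only-target s≡z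
        ; passes  = passes
        }
    body (no s≢z) =
      runTo P 8 50 (config 42 ρ μ o) (if-nonzero (d≢0 s≢z))
      (byKind kind refl s≢z)

  -- An iteration takes fewer than 50 steps, halting takes at most 5.
  loop : ∀ φ → Continues (φ * 50 + 5) φ
  loop φ (state found status [] τ []) inv bound ρ μ R =
    weaken P (m≤n+m 5 (φ * 50))
    (runTo P 2 78 (config 27 ρ μ o) (if-zero (trans (cong (_∸ ρ iR) (sym remAt)) (n∸n≡0 (ρ iR))))
    (runTo P 2 86 (config 78 ρ₁ μ o) (if-zero (trans (cong (_∸ ρ qhR) (sym queueAt)) (n∸n≡0 (ρ qhR))))
    (0 , o , done refl , z≤n , finish inv)))
    where
    open Represents′ R
    o = map toℕ found
    ρ₁ = Config.regs (run P 2 (config 27 ρ μ o))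
  -- Here and in the next clause the bound cannot be zero, because a queued task or a remaining
  -- entry makes the potential positive.
  loop (suc φ) (state found status ((z , t) ∷ queue) τ []) inv bound ρ μ R =
    weaken P (m≤n+m (16 + (φ * 50 + 5)) 34)
    (runTo P 2 78 (config 27 ρ μ o) (if-zero (trans (cong (_∸ ρ iR) (sym remAt)) (n∸n≡0 (ρ iR))))
    (runTo P 2 80 (config 78 ρ₁ μ o) (if-nonzero (m>n⇒m∸n≢0 (<⇒≤ (segment-≤ _ (proj₂ (proj₂ queueAt))))))
    (runTo P 6 21 (config 80 ρ₂ μ o) refl
    (scan ρ₃ μ R′ λ ρ R → loop φ _ (dequeue inv)
      (s≤s⁻¹ (subst (_≤ suc φ) (potential-dequeue {found} {status} {z , t} {queue} {τ}) bound)) ρ μ R))))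
    where
    open Represents′ R
    o = map toℕ found
    ρ₁ = Config.regs (run P 2 (config 27 ρ μ o))
    ρ₂ = Config.regs (run P 2 (config 78 ρ₁ μ o))
    ρ₃ = Config.regs (run P 6 (config 80 ρ₂ μ o))
    next≡ : ∀ a → a + ρ oneR ≡ suc a
    next≡ a = trans (cong (a +_) (at 2 constants≡)) (+-comm a 1)
    R′ : Represents ρ₃ μ (state found status queue (z , t) [])
    R′ = record
      { constants≡ = constants≡
      ; w≡         = proj₁ queueAt
      ; want≡      = All.head avoiding
      ; l≡         = trans (cong μ (next≡ (ρ qhR))) (proj₁ (proj₂ queueAt))
      ; remAt      = remAt
      ; j≤markA    = j≤markA
      ; inputAt    = inputAt
      ; mark       = mark
      ; markAt     = markAt
      ; marks      = marks
      ; statusAt   = statusAt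
      ; queueA≤qh  = ≤-trans queueA≤qh (≤-trans (m≤m+n (ρ qhR) (ρ oneR)) (m≤m+n _ (ρ oneR)))
      ; queueAt    = subst (λ i → Segment μ i (concatMap taskWords queue) (ρ qtR))
                       (sym (trans (next≡ _) (cong suc (next≡ (ρ qhR)))))
                       (proj₂ (proj₂ queueAt))
      ; avoiding   = All.tail avoiding
      }
  loop (suc φ) (state found status queue (z , t) (e ∷ rem)) inv bound ρ μ R =
    weaken P (m≤n+m (46 + (φ * 50 + 5)) 4)
    (runTo P 2 29 (config 27 ρ μ o) (if-nonzero (m>n⇒m∸n≢0 (segment-≤ (map toℕ rem) (proj₂ remAt))))
    (byTest (passes? t (label e))))
    where
    open Represents′ R
    o = map toℕ found
    ρ₁ = Config.regs (run P 2 (config 27 ρ μ o))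
    ρ₂ = Config.regs (run P 12 (config 29 ρ₁ μ o))
    e≡ : μ (ρ iR) ≡ toℕ e
    e≡ = proj₁ remAt
    b≡ : μ (ρ labR + μ (ρ iR)) ≡ label e
    b≡ = trans (cong μ (cong₂ _+_ (at 5 constants≡) e≡)) (Input.labels (input inputAt) e)
    R′ : Represents ρ₂ μ (state found status queue (z , t) rem)
    R′ = record
      { constants≡ = constants≡
      ; w≡         = w≡
      ; want≡      = want≡
      ; l≡         = l≡
      ; remAt      = subst (λ i → Segment μ i (map toℕ rem) (ρ jR))
                       (trans (+-comm 1 (ρ iR)) (cong (ρ iR +_) (sym (at 2 constants≡))))
                       (proj₂ remAt)
      ; j≤markA    = j≤markA
      ; inputAt    = inputAt
      ; mark       = mark
      ; markAt     = markAt
      ; marks      = marks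
      ; statusAt   = statusAt
      ; queueA≤qh  = queueA≤qh
      ; queueAt    = queueAt
      ; avoiding   = avoiding
      }
    byTest : Dec (Passes t (label e)) → Goal (44 + (φ * 50 + 5)) (config 29 ρ₁ μ o)
    byTest (yes pass) =
      runTo P 12 42 (config 29 ρ₁ μ o)
        (if-zero (verdict-pass t want≡ l≡ (at 2 constants≡) b≡ pass))
      (cross (loop φ) inv pass bound ρ₂ μ R′ e≡ b≡)
    byTest (no fail) =
      weaken P (m≤n+m (13 + (φ * 50 + 5)) 31)
      (runTo P 12 41 (config 29 ρ₁ μ o)
        (if-nonzero (verdict-fail t want≡ l≡ (at 2 constants≡) b≡ fail))
      (runTo P 1 27 (config 41 ρ₂ μ o) refl
      (loop φ _ (skip inv λ _ → fail) (s≤s⁻¹ bound)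
        (Config.regs (run P 1 (config 41 ρ₂ μ o))) μ R′)))

  -- For an arbitrary memory, as a symbolic run on the encoding itself is too costly.
  start-represents : ∀ μ → Segment μ 0 ws markA → (∀ k → μ (markA + k) ≡ 0) →
    Represents (Config.regs (run P 21 (config 0 (λ _ → 0) μ []))) μ
      (state [] (λ _ → fresh) [] (v , only x) [])
  start-represents μ s beyond = record
    { constants≡ = constants≡
    ; w≡         = proj₁ (proj₂ (proj₂ (proj₂ s)))
    ; want≡      = refl
    ; l≡         = proj₁ (proj₂ (proj₂ (proj₂ (proj₂ s))))
    ; remAt      = refl
    ; j≤markA    = z≤n
    ; inputAt    = s
    ; mark       = λ _ → 0
    -- The zeros beyond the input already form the mark array of an empty output and, next to it,
    -- the status array of vertices never entered.
    ; markAt     = segment-constant markA m beyond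
    ; marks      = λ _ → inj₁ (refl , λ ())
    ; statusAt   = segment-constant stA n λ k →
                     trans (cong μ (+-assoc markA m k)) (beyond (m + k))
    ; queueA≤qh  = ≤-reflexive (sym (cong₂ _+_ (at 9 constants≡) n≡))
    ; queueAt    = refl
    ; avoiding   = []
    }
    where
    n≡ : μ 1 ≡ n
    n≡ = proj₁ (proj₂ s)
    m≡ : μ 2 ≡ m
    m≡ = proj₁ (proj₂ (proj₂ s))
    -- The last start is the total length of the incidence lists, from which the program computes
    -- where free memory begins.
    starts-n : μ (offA + n) ≡ start n
    starts-n = trans (cong (λ k → μ (offA + k)) (sym (Fin.toℕ-fromℕ n)))
      (trans (Input.starts (input s) (fromℕ n)) (cong start (Fin.toℕ-fromℕ n)))
    offA-eq : 5 + μ 2 + μ 2 + μ 2 ≡ offA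
    offA-eq = cong (λ m → 5 + m + m + m) m≡
    lstA-eq : 5 + μ 2 + μ 2 + μ 2 + μ 1 + 1 ≡ lstA
    lstA-eq = trans (cong (_+ 1) (cong₂ _+_ offA-eq n≡))
      (trans (+-assoc offA n 1) (cong (offA +_) (+-comm n 1)))
    markA-eq : 5 + μ 2 + μ 2 + μ 2 + μ 1 + 1 + μ (5 + μ 2 + μ 2 + μ 2 + μ 1) ≡ markA
    markA-eq = cong₂ _+_ lstA-eq (trans (cong μ (cong₂ _+_ offA-eq n≡)) starts-n)
    constants≡ : map (Config.regs (run P 21 (config 0 (λ _ → 0) μ []))) (upTo 10) ≡ constants
    constants≡ = cong₂ _∷_ refl (cong₂ _∷_ (proj₁ s) (cong₂ _∷_ refl (cong₂ _∷_ refl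
      (cong₂ _∷_ (cong (5 +_) m≡) (cong₂ _∷_ (cong (λ m → 5 + m + m) m≡) (cong₂ _∷_ offA-eq
      (cong₂ _∷_ lstA-eq (cong₂ _∷_ markA-eq (cong₂ _∷_ (cong₂ _+_ markA-eq m≡) refl)))))))))

  fromMemory : ∀ μ → Segment μ 0 ws markA → (∀ k → μ (markA + k) ≡ 0) →
    Goal (27 + (9 * m * 50 + 5)) (config 0 (λ _ → 0) μ [])
  fromMemory μ s beyond = runTo P 21 21 (config 0 (λ _ → 0) μ []) refl
    (scan _ μ (start-represents μ s beyond) λ ρ R →
      loop (9 * m) start-state start-invariant start-potential ρ μ R)

  correct : Goal (482 * m) (initial ws)
  correct = weaken P bound (fromMemory (contents ws)
    (subst (Segment (contents ws) 0 ws) length-ws (segment-contents ws))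
    (λ k → trans (cong (λ a → contents ws (a + k)) (sym length-ws)) (contents-beyond ws k)))
    where
    -- The vertex `v` has an incident edge, so the overhead of 27 + 5 = 32 steps for setup and
    -- halting is absorbed into `32 * m`.
    m≥1 : 1 ≤ m
    m≥1 = ≤-trans (s≤s z≤n) (Fin.toℕ<n (proj₁ (noIsolated v)))
    bound : 27 + (9 * m * 50 + 5) ≤ 482 * m
    bound = begin
      27 + (9 * m * 50 + 5) ≡⟨ regroup 27 9 m 50 5 ⟩
      32 * 1 + 450 * m      ≤⟨ +-monoˡ-≤ (450 * m) (*-monoʳ-≤ 32 m≥1) ⟩
      32 * m + 450 * m      ≡⟨ *-distribʳ-+ m 32 450 ⟨
      482 * m               ∎
      where
      open ≤-Reasoning
      regroup : ∀ a b m c d → a + (b * m * c + d) ≡ (a + d) * 1 + b * c * m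
      regroup = solve-∀

theorem2 : Σ[ P ∈ Program ] Σ[ c ∈ ℕ ]
    ((G : Graph) (I : IncidenceLists G) (v : Graph.Vertex G) (x : ℕ) →
    Σ[ t ∈ ℕ ] Σ[ o ∈ List ℕ ]
    (HaltsIn P (initial (encode G I v x)) t o ×
    t ≤ c * Graph.m G ×
    Identifies o (OnNonrepetitivePath G v x)))
theorem2 = P , 482 , λ G I v x → Simulation.correct G I v x
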